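{- The satisfiability problem for Strategy Logic (SL) on finite models — deciding, given an SL sentence $\varphi$, whether there exists a concurrent game structure $G$ with finitely many actions and finitely many states such that $G\models\varphi$ — is undecidable.
   Context: Concurrent game structures (CGS) $G=(\mathrm{AP},\mathrm{Ag},\mathrm{Ac},\mathrm{St},\lambda,\tau,s_0)$: finite non-empty sets of atomic propositions and agents, countable non-empty sets of actions and states, initial state $s_0$, labeling $\lambda:\mathrm{St}\to2^{\mathrm{AP}}$, transition function $\tau:\mathrm{St}\times\mathrm{Ac}^{\mathrm{Ag}}\to\mathrm{St}$. A CGS is finite if both $\mathrm{Ac}$ and $\mathrm{St}$ are finite. Strategy Logic (SL) formulas: $\varphi::=p\mid\neg\varphi\mid\varphi\wedge\varphi\mid\varphi\vee\varphi\mid\mathsf{X}\varphi\mid\varphi\mathsf{U}\varphi\mid\varphi\mathsf{R}\varphi\mid\langle\langle x\rangle\rangle\varphi\mid[\![x]\!]\varphi\mid(a,x)\varphi$, where $\langle\langle x\rangle\rangle$ / $[\![x]\!]$ quantify existentially/universally over strategies (maps from finite histories of states to actions) assigned to variable $x$, $(a,x)$ binds agent $a$ to the strategy of $x$, and temporal operators are evaluated as in LTL along the unique play determined by the strategies bound to all agents; a sentence $\varphi$ holds in $G$ iff it holds at $s_0$ under the empty assignment. -}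

module Defs where

open import Data.Nat using (ℕ; zero; suc; _+_; _*_; _^_; _<_; _≡ᵇ_)
open import Data.Fin using (Fin; toℕ) renaming (_≟_ to _≟ᶠ_)
open import Data.Bool using (Bool; true; false; if_then_else_; T; _∨_; _∧_; not)
open import Data.Maybe using (Maybe; just; nothing)
open import Data.List.NonEmpty using (List⁺; [_]; head; _∷⁺_)
open import Data.Product using (Σ; _×_; _,_; proj₁)
open import Data.Sum using (_⊎_)
open import Data.Vec using (Vec; []; _∷_; lookup)
open import Relation.Nullary using (¬_; does)
open import Relation.Binary.PropositionalEquality using (_≡_)

Var : Set
Var = ℕ

data Formula (nAP nAg : ℕ) : Set where
  atom    : Fin nAP → Formula nAP nAg
  neg     : Formula nAP nAg → Formula nAP nAg
  and     : Formula nAP nAg → Formula nAP nAg → Formula nAP nAg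
  or      : Formula nAP nAg → Formula nAP nAg → Formula nAP nAg
  next    : Formula nAP nAg → Formula nAP nAg
  until   : Formula nAP nAg → Formula nAP nAg → Formula nAP nAg
  release : Formula nAP nAg → Formula nAP nAg → Formula nAP nAg
  exists  : Var → Formula nAP nAg → Formula nAP nAg
  foral  : Var → Formula nAP nAg → Formula nAP nAg
  bind    : Fin nAg → Var → Formula nAP nAg → Formula nAP nAg

-- Free agents and free variables (Mogavero et al.): temporal operators
-- make all agents free; (a,x) removes a and, if a was free, adds x.
freeAg : ∀ {nAP nAg} → Fin nAg → Formula nAP nAg → Bool
freeAg a (atom p)      = false
freeAg a (neg φ)       = freeAg a φ
freeAg a (and φ ψ)     = freeAg a φ ∨ freeAg a ψ
freeAg a (or φ ψ)      = freeAg a φ ∨ freeAg a ψ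
freeAg a (next φ)      = true
freeAg a (until φ ψ)   = true
freeAg a (release φ ψ) = true
freeAg a (exists x φ)  = freeAg a φ
freeAg a (foral x φ)  = freeAg a φ
freeAg a (bind b x φ)  = if does (a ≟ᶠ b) then false else freeAg a φ

freeVar : ∀ {nAP nAg} → Var → Formula nAP nAg → Bool
freeVar x (atom p)      = false
freeVar x (neg φ)       = freeVar x φ
freeVar x (and φ ψ)     = freeVar x φ ∨ freeVar x ψ
freeVar x (or φ ψ)      = freeVar x φ ∨ freeVar x ψ
freeVar x (next φ)      = freeVar x φ
freeVar x (until φ ψ)   = freeVar x φ ∨ freeVar x ψ
freeVar x (release φ ψ) = freeVar x φ ∨ freeVar x ψ
freeVar x (exists y φ)  = not (x ≡ᵇ y) ∧ freeVar x φ
freeVar x (foral y φ)  = not (x ≡ᵇ y) ∧ freeVar x φ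
freeVar x (bind b y φ)  = if freeAg b φ then ((x ≡ᵇ y) ∨ freeVar x φ) else freeVar x φ

Sentence : ∀ {nAP nAg} → Formula nAP nAg → Set
Sentence φ = (∀ a → freeAg a φ ≡ false) × (∀ x → freeVar x φ ≡ false)

record FinCGS (nAP nAg : ℕ) : Set where
  field
    nAc    : ℕ
    nSt    : ℕ
    nAc-pos : 0 < nAc
    label  : Fin nSt → Fin nAP → Bool
    trans  : Fin nSt → (Fin nAg → Fin nAc) → Fin nSt
    s₀     : Fin nSt

module Semantics {nAP nAg : ℕ} (G : FinCGS nAP nAg) where
  open FinCGS G

  -- histories: non-empty finite sequences of states, stored most
  -- recent state first (head = current state)
  History : Set
  History = List⁺ (Fin nSt)

  Strategy : Set
  Strategy = History → Fin nAc

  record Assignment : Set where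
    field
      agentOf : Fin nAg → Maybe Strategy
      varOf   : Var → Maybe Strategy
  open Assignment public

  empty : Assignment
  empty = record { agentOf = λ _ → nothing ; varOf = λ _ → nothing }

  setVar : Assignment → Var → Strategy → Assignment
  setVar χ x σ = record χ { varOf = λ y → if y ≡ᵇ x then just σ else varOf χ y }

  setAgent : Assignment → Fin nAg → Maybe Strategy → Assignment
  setAgent χ a m = record χ
    { agentOf = λ b → if does (b ≟ᶠ a) then m else agentOf χ b }

  Total : Assignment → Set
  Total χ = (a : Fin nAg) → Σ Strategy λ σ → agentOf χ a ≡ just σ

  step : ∀ χ → Total χ → History → History
  step χ t h = trans (head h) (λ a → proj₁ (t a) h) ∷⁺ h

  run : ∀ χ → Total χ → ℕ → History → History
  run χ t zero    h = h
  run χ t (suc i) h = step χ t (run χ t i h)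

  Sat : Formula nAP nAg → Assignment → History → Set
  Sat (atom p)      χ h = T (label (head h) p)
  Sat (neg φ)       χ h = ¬ Sat φ χ h
  Sat (and φ ψ)     χ h = Sat φ χ h × Sat ψ χ h
  Sat (or φ ψ)      χ h = Sat φ χ h ⊎ Sat ψ χ h
  Sat (next φ)      χ h = Σ (Total χ) λ t → Sat φ χ (step χ t h)
  Sat (until φ ψ)   χ h = Σ (Total χ) λ t → Σ ℕ λ i →
    Sat ψ χ (run χ t i h) × (∀ j → j < i → Sat φ χ (run χ t j h))
  Sat (release φ ψ) χ h = Σ (Total χ) λ t → ∀ i →
    Sat ψ χ (run χ t i h) ⊎ (Σ ℕ λ j → j < i × Sat φ χ (run χ t j h))
  Sat (exists x φ)  χ h = Σ Strategy λ σ → Sat φ (setVar χ x σ) h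
  Sat (foral x φ)  χ h = (σ : Strategy) → Sat φ (setVar χ x σ) h
  Sat (bind a x φ)  χ h = Sat φ (setAgent χ a (varOf χ x)) h

  Models : Formula nAP nAg → Set
  Models φ = Sat φ empty [ s₀ ]

record SLInput : Set where
  field
    p g      : ℕ
    φ        : Formula (suc p) (suc g)
    sentence : Sentence φ

FinSat : SLInput → Set
FinSat i = Σ (FinCGS (suc p) (suc g)) λ G → Semantics.Models G φ
  where open SLInput i

pair : ℕ → ℕ → ℕ
pair a b = 2 ^ a * suc (2 * b)

codeF : ∀ {nAP nAg} → Formula nAP nAg → ℕ
codeF (atom p)      = pair 0 (toℕ p)
codeF (neg φ)       = pair 1 (codeF φ)
codeF (and φ ψ)     = pair 2 (pair (codeF φ) (codeF ψ))
codeF (or φ ψ)      = pair 3 (pair (codeF φ) (codeF ψ))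
codeF (next φ)      = pair 4 (codeF φ)
codeF (until φ ψ)   = pair 5 (pair (codeF φ) (codeF ψ))
codeF (release φ ψ) = pair 6 (pair (codeF φ) (codeF ψ))
codeF (exists x φ)  = pair 7 (pair x (codeF φ))
codeF (foral x φ)  = pair 8 (pair x (codeF φ))
codeF (bind a x φ)  = pair 9 (pair (toℕ a) (pair x (codeF φ)))

code : SLInput → ℕ
code i = pair (SLInput.p i) (pair (SLInput.g i) (codeF (SLInput.φ i)))

data PR : ℕ → Set where
  zer  : ∀ {n} → PR n
  succ : PR 1
  proj : ∀ {n} → Fin n → PR n
  comp : ∀ {m n} → PR m → Vec (PR n) m → PR n
  rec  : ∀ {n} → PR n → PR (suc (suc n)) → PR (suc n)
  mu   : ∀ {n} → PR (suc n) → PR n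

mutual
  data _[_]⇓_ : ∀ {n} → PR n → Vec ℕ n → ℕ → Set where
    ev-zer  : ∀ {n} {xs : Vec ℕ n} → zer [ xs ]⇓ 0
    ev-succ : ∀ {x} → succ [ x ∷ [] ]⇓ suc x
    ev-proj : ∀ {n} {xs : Vec ℕ n} {i} → proj i [ xs ]⇓ lookup xs i
    ev-comp : ∀ {m n} {f : PR m} {gs : Vec (PR n) m} {xs ys z} →
              gs [ xs ]⇓* ys → f [ ys ]⇓ z → comp f gs [ xs ]⇓ z
    ev-rec0 : ∀ {n} {f : PR n} {g} {xs z} →
              f [ xs ]⇓ z → rec f g [ 0 ∷ xs ]⇓ z
    ev-recS : ∀ {n} {f : PR n} {g} {xs y r z} →
              rec f g [ y ∷ xs ]⇓ r → g [ y ∷ r ∷ xs ]⇓ z →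
              rec f g [ suc y ∷ xs ]⇓ z
    ev-mu   : ∀ {n} {f : PR (suc n)} {xs y} →
              f [ y ∷ xs ]⇓ 0 →
              (∀ z → z < y → Σ ℕ λ v → f [ z ∷ xs ]⇓ suc v) →
              mu f [ xs ]⇓ y

  data _[_]⇓*_ : ∀ {m n} → Vec (PR n) m → Vec ℕ n → Vec ℕ m → Set where
    ev-nil  : ∀ {n} {xs : Vec ℕ n} → [] [ xs ]⇓* []
    ev-cons : ∀ {m n} {g : PR n} {gs : Vec (PR n) m} {xs y ys} →
              g [ xs ]⇓ y → gs [ xs ]⇓* ys → (g ∷ gs) [ xs ]⇓* (y ∷ ys)

Decides : {I : Set} → PR 1 → (I → Set) → (I → ℕ) → Set
Decides {I} f P c = (i : I) →
  (P i → f [ c i ∷ [] ]⇓ 1) × (¬ P i → f [ c i ∷ [] ]⇓ 0)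

{-# OPTIONS --safe #-}
-- At the initial state a strategy is as good as its first action, so SL sentences can quantify over a
-- finite set of numbers (the actions) and, by one more move, let a strategy answer yes or no to each
-- pair of actions: this is quantification over binary relations.  With a linear order and a successor
-- on the actions, the graph of every recursive function is therefore definable, and "g(k) = 0"
-- becomes satisfiability in a finite game with enough actions.  If f decided satisfiability, take for
-- g the function that sends the code of a template formula T to f(code of T with the numeral of its own
-- code plugged in); plugging the template of g into itself yields a sentence that is satisfiable
-- exactly when f rejects it.
module Submission where

open import Defs
open import Data.Nat using (ℕ; zero; suc; _+_; _*_; _^_; _≤_; _<_; _≡ᵇ_; _⊔_; z≤n; s≤s; s≤s⁻¹)
open import Data.Nat.Properties
open import Data.Bool using (true; false; T; _∨_)
open import Data.Bool.Properties using (∧-zeroʳ)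
open import Data.Fin using (Fin; zero; suc; toℕ; fromℕ<; combine; remQuot; _↑ˡ_; _↑ʳ_; #_)
open import Data.Fin.Properties using (toℕ<n; toℕ-fromℕ<; remQuot-combine)
open import Data.Fin.Induction using (spo-wellFounded)
open import Data.List.NonEmpty using ([_]; head; _∷⁺_)
open import Data.Maybe using (just)
open import Data.Maybe.Properties using (just-injective)
open import Data.Product using (Σ; _×_; _,_; proj₁; proj₂)
open import Data.Sum using (_⊎_; inj₁; inj₂; map₂)
open import Data.Vec using (Vec; []; _∷_; lookup; tabulate)
open import Data.Vec.Properties using (lookup∘tabulate; tabulate-cong)
open import Function using (_∘_; id; const)
open import Induction.WellFounded using (WellFounded; Acc; acc; module Subrelation)
open import Relation.Binary.Construct.On using (wellFounded)
open import Relation.Binary.Structures using (IsStrictPartialOrder)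
open import Relation.Binary.Definitions using (tri<; tri≈; tri>)
open import Relation.Binary.PropositionalEquality
  using (_≡_; _≢_; refl; sym; trans; cong; cong₂; subst; subst₂; isEquivalence; resp₂)
open import Relation.Nullary using (¬_; Dec; yes; no; contradiction)
open import Relation.Nullary.Decidable
  using (dec-true; dec-false; isYes; toWitness; fromWitness; map′; _×-dec_; _⊎-dec_)

-- Evaluation of recursive functions, and the pairing code as one of them.

mutual
  ⇓-deterministic : ∀ {n} {g : PR n} {xs y z} → g [ xs ]⇓ y → g [ xs ]⇓ z → y ≡ z
  ⇓-deterministic ev-zer ev-zer = refl
  ⇓-deterministic ev-succ ev-succ = refl
  ⇓-deterministic ev-proj ev-proj = refl
  ⇓-deterministic (ev-comp ds d) (ev-comp es e) with refl ← ⇓*-deterministic ds es = ⇓-deterministic d e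
  ⇓-deterministic (ev-rec0 d) (ev-rec0 e) = ⇓-deterministic d e
  ⇓-deterministic (ev-recS d d′) (ev-recS e e′) with refl ← ⇓-deterministic d e = ⇓-deterministic d′ e′
  -- If the results differed, one derivation would make the function 0 at the smaller of them, while
  -- the other makes it positive there.
  ⇓-deterministic (ev-mu {y = y} d ds) (ev-mu {y = z} e es) with <-cmp y z
  ... | tri< y<z _ _ with () ← ⇓-deterministic d (proj₂ (es y y<z))
  ... | tri≈ _ y≡z _ = y≡z
  ... | tri> _ _ z<y with () ← ⇓-deterministic (proj₂ (ds z z<y)) e

  ⇓*-deterministic : ∀ {m n} {gs : Vec (PR n) m} {xs ys zs} → gs [ xs ]⇓* ys → gs [ xs ]⇓* zs → ys ≡ zs
  ⇓*-deterministic ev-nil ev-nil = refl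
  ⇓*-deterministic (ev-cons d ds) (ev-cons e es) = cong₂ _∷_ (⇓-deterministic d e) (⇓*-deterministic ds es)

infixr 9 _⊙_
_⊙_ : ∀ {n} → PR 1 → PR n → PR n
f ⊙ g = comp f (g ∷ [])

⊙-⇓ : ∀ {n} {f : PR 1} {g : PR n} {xs y z} → g [ xs ]⇓ y → f [ y ∷ [] ]⇓ z → (f ⊙ g) [ xs ]⇓ z
⊙-⇓ d e = ev-comp (ev-cons d ev-nil) e

⊙-inv : ∀ {n} {f : PR 1} {g : PR n} {xs y z} → g [ xs ]⇓ y → (f ⊙ g) [ xs ]⇓ z → f [ y ∷ [] ]⇓ z
⊙-inv d (ev-comp (ev-cons e ev-nil) e′) with refl ← ⇓-deterministic d e = e′

double : PR 1
double = rec zer (succ ⊙ succ ⊙ proj (# 1))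

double-⇓ : ∀ n → double [ n ∷ [] ]⇓ (2 * n)
double-⇓ zero = ev-rec0 ev-zer
double-⇓ (suc n) = subst (double [ suc n ∷ [] ]⇓_) (sym (*-suc 2 n))
  (ev-recS (double-⇓ n) (⊙-⇓ (⊙-⇓ ev-proj ev-succ) ev-succ))

-- The first component is always known in advance, so multiplication by `2 ^ a` is programmed as `a`
-- doublings.
pairing : ℕ → PR 1
pairing zero    = succ ⊙ double
pairing (suc a) = double ⊙ pairing a

pairing-⇓ : ∀ a b → pairing a [ b ∷ [] ]⇓ pair a b
pairing-⇓ zero b = subst (pairing zero [ b ∷ [] ]⇓_) (sym (*-identityˡ (suc (2 * b))))
  (⊙-⇓ (double-⇓ b) ev-succ)
pairing-⇓ (suc a) b = subst (pairing (suc a) [ b ∷ [] ]⇓_) (sym (*-assoc 2 (2 ^ a) (suc (2 * b))))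
  (⊙-⇓ (pairing-⇓ a b) (double-⇓ (pair a b)))

-- Formula codes and self-substitution.

SL : Set
SL = Formula 4 2

-- Opaque because unfolding pair on the literal tags is unary arithmetic that never ends in practice.
opaque
  encode : SL → ℕ
  encode = codeF

  encode≡codeF : ∀ φ → encode φ ≡ codeF φ
  encode≡codeF φ = refl

  encode-and : ∀ φ ψ → encode (and φ ψ) ≡ pair 2 (pair (encode φ) (encode ψ))
  encode-and φ ψ = refl

  encode-exists : ∀ x φ → encode (exists x φ) ≡ pair 7 (pair x (encode φ))
  encode-exists x φ = refl

andP : SL → PR 1
andP φ = pairing 2 ⊙ pairing (encode φ)

andP-⇓ : ∀ φ ψ → andP φ [ encode ψ ∷ [] ]⇓ encode (and φ ψ)
andP-⇓ φ ψ = subst (andP φ [ encode ψ ∷ [] ]⇓_) (sym (encode-and φ ψ))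
  (⊙-⇓ (pairing-⇓ (encode φ) (encode ψ)) (pairing-⇓ 2 (pair (encode φ) (encode ψ))))

existsP : Var → PR 1
existsP x = pairing 7 ⊙ pairing x

existsP-⇓ : ∀ x φ → existsP x [ encode φ ∷ [] ]⇓ encode (exists x φ)
existsP-⇓ x φ = subst (existsP x [ encode φ ∷ [] ]⇓_) (sym (encode-exists x φ))
  (⊙-⇓ (pairing-⇓ x (encode φ)) (pairing-⇓ 7 (pair x (encode φ))))

module Template (α ζ σ ε : SL) where

  -- With σ and ε saying "1 is the successor of 0" and "0 equals 1" for the variables 0 and 1,
  -- climb k adds k to variable 0; its code is a k-fold iterate, so no numeral has to be coded.
  climb : ℕ → SL → SL
  climb zero    ψ = ψ
  climb (suc k) ψ = exists 1 (and σ (exists 0 (and ε (climb k ψ))))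

  climbP : PR 2
  climbP = rec (proj zero) (existsP 1 ⊙ andP σ ⊙ existsP 0 ⊙ andP ε ⊙ proj (suc zero))

  climbP-⇓ : ∀ k ψ → climbP [ k ∷ encode ψ ∷ [] ]⇓ encode (climb k ψ)
  climbP-⇓ zero ψ = ev-rec0 ev-proj
  climbP-⇓ (suc k) ψ = ev-recS (climbP-⇓ k ψ)
    (⊙-⇓ (⊙-⇓ (⊙-⇓ (⊙-⇓ ev-proj (andP-⇓ ε χ)) (existsP-⇓ 0 (and ε χ)))
      (andP-⇓ σ (exists 0 (and ε χ)))) (existsP-⇓ 1 (and σ (exists 0 (and ε χ)))))
    where χ = climb k ψ

  plug : ℕ → SL → SL
  plug k ψ = and α (exists 0 (and ζ (climb k ψ)))

  plugP : PR 1
  -- The tags 3 and 1 are the fields `p` and `g` of an input with 4 propositions and 2 agents.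
  -- `climbP` receives the argument of `plugP` twice, as number and as code: this is the diagonal
  -- map.
  plugP = pairing 3 ⊙ pairing 1 ⊙ andP α ⊙ existsP 0 ⊙ andP ζ ⊙ comp climbP (proj zero ∷ proj zero ∷ [])

  plugP-⇓ : ∀ ψ → plugP [ encode ψ ∷ [] ]⇓ pair 3 (pair 1 (encode (plug (encode ψ) ψ)))
  plugP-⇓ ψ =
    ⊙-⇓ (⊙-⇓ (⊙-⇓ (⊙-⇓ (⊙-⇓ (ev-comp (ev-cons ev-proj (ev-cons ev-proj ev-nil)) (climbP-⇓ (encode ψ) ψ))
      (andP-⇓ ζ χ)) (existsP-⇓ 0 (and ζ χ))) (andP-⇓ α (exists 0 (and ζ χ))))
      (pairing-⇓ 1 c)) (pairing-⇓ 3 (pair 1 c))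
    where
    χ = climb (encode ψ) ψ
    c = encode (plug (encode ψ) ψ)

-- A logic of numbers and binary relations, and its translation into SL.

lt-rel suc-rel zero-rel eq-rel : Fin 4
lt-rel   = # 0
suc-rel  = # 1
zero-rel = # 2
eq-rel   = # 3

infix 7 ¬̇_ ∃̇_ ∀̇_
infixr 6 _∧̇_
infixr 5 _∨̇_
data Fm (n : ℕ) : Set where
  rel      : Fin 4 → Fin n → Fin n → Fm n
  app      : Fin n → Fin n → Fin n → Fm n
  ¬̇_       : Fm n → Fm n
  _∧̇_ _∨̇_  : Fm n → Fm n → Fm n
  ∃̇_ ∀̇_    : Fm (suc n) → Fm n

infixr 5 _▹_
_▹_ : ∀ {ℓ} {A : Set ℓ} {n} → A → (Fin n → A) → Fin (suc n) → A
(a ▹ ρ) zero    = a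
(a ▹ ρ) (suc i) = ρ i

∅ : ∀ {ℓ} {A : Set ℓ} → Fin 0 → A
∅ ()

module Eval {A : Set} (Rel : Fin 4 → A → A → Set) (App : A → A → A → Set) where
  ⟦_⟧ : ∀ {n} → Fm n → (Fin n → A) → Set
  ⟦ rel j x y ⟧ ρ = Rel j (ρ x) (ρ y)
  ⟦ app r x y ⟧ ρ = App (ρ r) (ρ x) (ρ y)
  ⟦ ¬̇ φ ⟧       ρ = ¬ ⟦ φ ⟧ ρ
  ⟦ φ ∧̇ ψ ⟧     ρ = ⟦ φ ⟧ ρ × ⟦ ψ ⟧ ρ
  ⟦ φ ∨̇ ψ ⟧     ρ = ⟦ φ ⟧ ρ ⊎ ⟦ ψ ⟧ ρ
  ⟦ ∃̇ φ ⟧       ρ = Σ A λ a → ⟦ φ ⟧ (a ▹ ρ)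
  ⟦ ∀̇ φ ⟧       ρ = (a : A) → ⟦ φ ⟧ (a ▹ ρ)

-- Variables are de Bruijn indices in Fm and de Bruijn levels in the translation.
level : ∀ {n} → Fin n → Var
level {suc n} zero    = n
level {suc n} (suc i) = level i

level< : ∀ {n} (i : Fin n) → level i < n
level< zero    = n<1+n _
level< (suc i) = m<n⇒m<1+n (level< i)

afterPlaying : Var → Var → SL → SL
afterPlaying x y φ = bind (# 0) x (bind (# 1) y (next φ))

relSL : Fin 4 → Var → Var → SL
relSL j x y = afterPlaying x y (atom j)

-- The strategy r relates x to y if, after x and y have been played, its next action is a zero.
toSL : ∀ {n} → Fm n → SL
toSL (rel j x y)  = relSL j (level x) (level y)
-- Being zero is the diagonal of a binary label, so in the second round both agents play `r`.
toSL (app r x y)  = afterPlaying (level x) (level y) (relSL zero-rel (level r) (level r))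
toSL (¬̇ φ)        = neg (toSL φ)
toSL (φ ∧̇ ψ)      = and (toSL φ) (toSL ψ)
toSL (φ ∨̇ ψ)      = or (toSL φ) (toSL ψ)
toSL {n} (∃̇ φ)    = exists n (toSL φ)
toSL {n} (∀̇ φ)    = foral n (toSL φ)

≡ᵇ-refl : ∀ n → (n ≡ᵇ n) ≡ true
≡ᵇ-refl n = dec-true (n ≟ n) refl

≢⇒≡ᵇ-false : ∀ {m n} → m ≢ n → (m ≡ᵇ n) ≡ false
≢⇒≡ᵇ-false {m} {n} m≢n = dec-false (m ≟ n) m≢n

NoFreeAg : SL → Set
NoFreeAg φ = ∀ a → freeAg a φ ≡ false

FreeVarsBelow : ℕ → SL → Set
FreeVarsBelow n φ = ∀ z → n ≤ z → freeVar z φ ≡ false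

∨-false : ∀ {a b} → a ≡ false → b ≡ false → a ∨ b ≡ false
∨-false refl refl = refl

-- Both agents are bound in front of `next`, which removes them whatever `φ` contains; nesting two
-- rounds is therefore harmless.
afterPlaying-noFreeAg : ∀ x y φ → NoFreeAg (afterPlaying x y φ)
afterPlaying-noFreeAg x y φ zero       = refl
afterPlaying-noFreeAg x y φ (suc zero) = refl

afterPlaying-freeVars : ∀ {n x y φ} → x < n → y < n → FreeVarsBelow n φ → FreeVarsBelow n (afterPlaying x y φ)
afterPlaying-freeVars x<n y<n φ< z n≤z =
  ∨-false (≢⇒≡ᵇ-false (>⇒≢ (<-≤-trans x<n n≤z))) (∨-false (≢⇒≡ᵇ-false (>⇒≢ (<-≤-trans y<n n≤z))) (φ< z n≤z))

exists-freeVars : ∀ {n} φ → FreeVarsBelow (suc n) φ → FreeVarsBelow n (exists n φ)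
exists-freeVars {n} φ φ< z n≤z with n ≟ z
... | yes refl rewrite ≡ᵇ-refl n = refl
... | no  n≢z  rewrite φ< z (≤∧≢⇒< n≤z n≢z) = ∧-zeroʳ _

relSL-freeVars : ∀ {n} j {x y} → x < n → y < n → FreeVarsBelow n (relSL j x y)
relSL-freeVars j x<n y<n = afterPlaying-freeVars {φ = atom j} x<n y<n λ _ _ → refl

toSL-noFreeAg : ∀ {n} (φ : Fm n) → NoFreeAg (toSL φ)
toSL-noFreeAg (rel j x y) = afterPlaying-noFreeAg (level x) (level y) (atom j)
toSL-noFreeAg (app r x y) = afterPlaying-noFreeAg (level x) (level y) (relSL zero-rel (level r) (level r))
toSL-noFreeAg (¬̇ φ)       = toSL-noFreeAg φ
toSL-noFreeAg (φ ∧̇ ψ) a   = ∨-false (toSL-noFreeAg φ a) (toSL-noFreeAg ψ a)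
toSL-noFreeAg (φ ∨̇ ψ) a   = ∨-false (toSL-noFreeAg φ a) (toSL-noFreeAg ψ a)
toSL-noFreeAg (∃̇ φ)       = toSL-noFreeAg φ
toSL-noFreeAg (∀̇ φ)       = toSL-noFreeAg φ

toSL-freeVars : ∀ {n} (φ : Fm n) → FreeVarsBelow n (toSL φ)
toSL-freeVars (rel j x y)     = relSL-freeVars j (level< x) (level< y)
toSL-freeVars (app r x y)     = afterPlaying-freeVars {φ = relSL zero-rel (level r) (level r)}
  (level< x) (level< y) (relSL-freeVars zero-rel (level< r) (level< r))
toSL-freeVars (¬̇ φ)           = toSL-freeVars φ
toSL-freeVars (φ ∧̇ ψ) z n≤z   = ∨-false (toSL-freeVars φ z n≤z) (toSL-freeVars ψ z n≤z)
toSL-freeVars (φ ∨̇ ψ) z n≤z   = ∨-false (toSL-freeVars φ z n≤z) (toSL-freeVars ψ z n≤z)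
toSL-freeVars (∃̇ φ)           = exists-freeVars (toSL φ) (toSL-freeVars φ)
toSL-freeVars (∀̇ φ)           = exists-freeVars (toSL φ) (toSL-freeVars φ)

-- Meaning of translated formulas in an arbitrary finite game.

module StrategyStructure (G : FinCGS 4 2) where
  open FinCGS G renaming (trans to move)
  open Semantics G

  -- Without function extensionality the transition function may distinguish
  -- pointwise equal joint actions, hence the existential over joint strategies.
  Next : Strategy → Strategy → (History → Set) → History → Set
  Next σ τ P h = Σ (Fin 2 → Strategy) λ f →
    f (# 0) ≡ σ × f (# 1) ≡ τ × P (move (head h) (λ a → f a h) ∷⁺ h)

  root : History
  root = [ s₀ ]

  Labelled : Fin 4 → History → Set
  Labelled j h = T (label (head h) j)

  Rel : Fin 4 → Strategy → Strategy → Set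
  Rel j σ τ = Next σ τ (Labelled j) root

  App : Strategy → Strategy → Strategy → Set
  App ρ σ τ = Next σ τ (Next ρ ρ (Labelled zero-rel)) root

  open Eval Rel App public

  played : Var → Var → Assignment → Assignment
  played x y χ = setAgent (setAgent χ (# 0) (varOf χ x)) (# 1) (varOf χ y)

  Sat⇒Next : ∀ x y χ φ {σ τ h} {P : History → Set} → varOf χ x ≡ just σ → varOf χ y ≡ just τ →
    (∀ h′ → Sat φ (played x y χ) h′ → P h′) → Sat (afterPlaying x y φ) χ h → Next σ τ P h
  Sat⇒Next x y χ φ χx χy sat⇒P (t , s) = (λ a → proj₁ (t a)) ,
    just-injective (trans (sym (proj₂ (t (# 0)))) χx) ,
    just-injective (trans (sym (proj₂ (t (# 1)))) χy) , sat⇒P _ s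

  Next⇒Sat : ∀ x y χ φ {σ τ h} {P : History → Set} → varOf χ x ≡ just σ → varOf χ y ≡ just τ →
    (∀ h′ → P h′ → Sat φ (played x y χ) h′) → Next σ τ P h → Sat (afterPlaying x y φ) χ h
  Next⇒Sat x y χ φ χx χy P⇒sat (f , f0≡σ , f1≡τ , p) = (λ a → f a , bound a) , P⇒sat _ p
    where
    bound : ∀ a → agentOf (played x y χ) a ≡ just (f a)
    bound zero       = trans χx (cong just (sym f0≡σ))
    bound (suc zero) = trans χy (cong just (sym f1≡τ))

  Sat⇒Rel : ∀ j x y χ {σ τ} → varOf χ x ≡ just σ → varOf χ y ≡ just τ → Sat (relSL j x y) χ root → Rel j σ τ
  Sat⇒Rel j x y χ χx χy = Sat⇒Next x y χ (atom j) χx χy λ _ → id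

  Rel⇒Sat : ∀ j x y χ {σ τ} → varOf χ x ≡ just σ → varOf χ y ≡ just τ → Rel j σ τ → Sat (relSL j x y) χ root
  Rel⇒Sat j x y χ χx χy = Next⇒Sat x y χ (atom j) χx χy λ _ → id

  setVar-same : ∀ χ x σ → varOf (setVar χ x σ) x ≡ just σ
  setVar-same χ x σ rewrite ≡ᵇ-refl x = refl

  setVar-other : ∀ χ {x} σ {y} → y ≢ x → varOf (setVar χ x σ) y ≡ varOf χ y
  setVar-other χ σ y≢x rewrite ≢⇒≡ᵇ-false y≢x = refl

  Agrees : ∀ {n} → Assignment → (Fin n → Strategy) → Set
  Agrees χ ρ = ∀ i → varOf χ (level i) ≡ just (ρ i)

  Agrees-▹ : ∀ {n} χ {ρ : Fin n → Strategy} σ → Agrees χ ρ → Agrees (setVar χ n σ) (σ ▹ ρ)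
  Agrees-▹ {n} χ σ χ∼ρ zero    = setVar-same χ n σ
  Agrees-▹ {n} χ σ χ∼ρ (suc i) = trans (setVar-other χ σ (<⇒≢ (level< i))) (χ∼ρ i)

  mutual
    -- Negation exchanges the two directions, hence the mutual induction. Quantifiers and
    -- connectives stay at `root`, and atoms rebind both agents, so agreement on variables is all
    -- that must be carried along.
    Sat⇒⟦⟧ : ∀ {n} (φ : Fm n) χ {ρ} → Agrees χ ρ → Sat (toSL φ) χ root → ⟦ φ ⟧ ρ
    Sat⇒⟦⟧ (rel j x y) χ χ∼ρ        = Sat⇒Rel j (level x) (level y) χ (χ∼ρ x) (χ∼ρ y)
    Sat⇒⟦⟧ (app r x y) χ χ∼ρ        =
      Sat⇒Next (level x) (level y) χ (relSL zero-rel (level r) (level r)) (χ∼ρ x) (χ∼ρ y) λ _ →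
      Sat⇒Next (level r) (level r) (played (level x) (level y) χ) (atom zero-rel) (χ∼ρ r) (χ∼ρ r) λ _ → id
    Sat⇒⟦⟧ (¬̇ φ) χ χ∼ρ ¬s s        = ¬s (⟦⟧⇒Sat φ χ χ∼ρ s)
    Sat⇒⟦⟧ (φ ∧̇ ψ) χ χ∼ρ (s , t)   = Sat⇒⟦⟧ φ χ χ∼ρ s , Sat⇒⟦⟧ ψ χ χ∼ρ t
    Sat⇒⟦⟧ (φ ∨̇ ψ) χ χ∼ρ (inj₁ s)  = inj₁ (Sat⇒⟦⟧ φ χ χ∼ρ s)
    Sat⇒⟦⟧ (φ ∨̇ ψ) χ χ∼ρ (inj₂ t)  = inj₂ (Sat⇒⟦⟧ ψ χ χ∼ρ t)
    Sat⇒⟦⟧ (∃̇ φ) χ χ∼ρ (σ , s)     = σ , Sat⇒⟦⟧ φ _ (Agrees-▹ χ σ χ∼ρ) s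
    Sat⇒⟦⟧ (∀̇ φ) χ χ∼ρ s σ         = Sat⇒⟦⟧ φ _ (Agrees-▹ χ σ χ∼ρ) (s σ)

    ⟦⟧⇒Sat : ∀ {n} (φ : Fm n) χ {ρ} → Agrees χ ρ → ⟦ φ ⟧ ρ → Sat (toSL φ) χ root
    ⟦⟧⇒Sat (rel j x y) χ χ∼ρ        = Rel⇒Sat j (level x) (level y) χ (χ∼ρ x) (χ∼ρ y)
    ⟦⟧⇒Sat (app r x y) χ χ∼ρ        =
      Next⇒Sat (level x) (level y) χ (relSL zero-rel (level r) (level r)) (χ∼ρ x) (χ∼ρ y) λ _ →
      Next⇒Sat (level r) (level r) (played (level x) (level y) χ) (atom zero-rel) (χ∼ρ r) (χ∼ρ r) λ _ → id
    ⟦⟧⇒Sat (¬̇ φ) χ χ∼ρ ¬s s        = ¬s (Sat⇒⟦⟧ φ χ χ∼ρ s)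
    ⟦⟧⇒Sat (φ ∧̇ ψ) χ χ∼ρ (s , t)   = ⟦⟧⇒Sat φ χ χ∼ρ s , ⟦⟧⇒Sat ψ χ χ∼ρ t
    ⟦⟧⇒Sat (φ ∨̇ ψ) χ χ∼ρ (inj₁ s)  = inj₁ (⟦⟧⇒Sat φ χ χ∼ρ s)
    ⟦⟧⇒Sat (φ ∨̇ ψ) χ χ∼ρ (inj₂ t)  = inj₂ (⟦⟧⇒Sat ψ χ χ∼ρ t)
    ⟦⟧⇒Sat (∃̇ φ) χ χ∼ρ (σ , s)     = σ , ⟦⟧⇒Sat φ _ (Agrees-▹ χ σ χ∼ρ) s
    ⟦⟧⇒Sat (∀̇ φ) χ χ∼ρ s σ         = ⟦⟧⇒Sat φ _ (Agrees-▹ χ σ χ∼ρ) (s σ)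

-- Axioms of arithmetic and formulas for graphs of recursive functions.

infix 9 _<̇_ _is-suc-of_ _≐_
_<̇_ _is-suc-of_ _≐_ : ∀ {n} → Fin n → Fin n → Fm n
x <̇ y         = rel lt-rel x y
y is-suc-of x = rel suc-rel x y
x ≐ y         = rel eq-rel x y

is-zero : ∀ {n} → Fin n → Fm n
is-zero x = rel zero-rel x x

infixr 4 _⊃̇_
_⊃̇_ : ∀ {n} → Fm n → Fm n → Fm n
φ ⊃̇ ψ = ¬̇ φ ∨̇ ψ

-- In order: the order is irreflexive and transitive; successors are larger, are not zero and have a
-- unique predecessor; zero and successor respect `≐`; everything is zero or a successor. An axiom
-- giving every element a successor would exclude all finite games.
arithmetic : Fm 0
arithmetic =
    (∀̇ ¬̇ # 0 <̇ # 0)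
  ∧̇ (∀̇ ∀̇ ∀̇ (# 0 <̇ # 1 ⊃̇ # 1 <̇ # 2 ⊃̇ # 0 <̇ # 2))
  ∧̇ (∀̇ ∀̇ (# 1 is-suc-of # 0 ⊃̇ # 0 <̇ # 1))
  ∧̇ (∀̇ ∀̇ (# 1 is-suc-of # 0 ⊃̇ ¬̇ is-zero (# 1)))
  ∧̇ (∀̇ ∀̇ ∀̇ (# 2 is-suc-of # 0 ⊃̇ # 2 is-suc-of # 1 ⊃̇ # 0 ≐ # 1))
  ∧̇ (∀̇ ∀̇ (# 0 ≐ # 1 ⊃̇ is-zero (# 0) ⊃̇ is-zero (# 1)))
  ∧̇ (∀̇ ∀̇ ∀̇ (# 0 ≐ # 1 ⊃̇ # 0 is-suc-of # 2 ⊃̇ # 1 is-suc-of # 2))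
  ∧̇ (∀̇ (is-zero (# 0) ∨̇ ∃̇ (# 1 is-suc-of # 0)))

∃̇^ : ∀ m {n} → Fm (m + n) → Fm n
∃̇^ zero    φ = φ
∃̇^ (suc m) φ = ∃̇^ m (∃̇ φ)

-- For primitive recursion, a binary relation on numbers is quantified,
-- every pair of which is justified by an earlier one.
mutual
  graph : ∀ {k n} → PR k → (Fin k → Fin n) → Fin n → Fm n
  graph zer xs y        = is-zero y
  graph succ xs y       = y is-suc-of xs (# 0)
  graph (proj i) xs y   = xs i ≐ y
  graph (comp {m} f gs) xs y =
    ∃̇^ m (graphs gs ((m ↑ʳ_) ∘ xs) (_↑ˡ _) ∧̇ graph f (_↑ˡ _) (m ↑ʳ y))
  graph (rec f g) xs y  =
    ∃̇ (app (# 0) (suc (xs (# 0))) (suc y) ∧̇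
    ∀̇ ∀̇ (app (# 2) (# 1) (# 0) ⊃̇
      (is-zero (# 1) ∧̇ graph f (λ i → suc (suc (suc (xs (suc i))))) (# 0)) ∨̇
      -- Here `# 4` is the table, `# 3` and `# 2` the current argument and value, `# 1` and `# 0`
      -- the preceding argument and its tabulated value.
      (∃̇ ∃̇ (# 3 is-suc-of # 1 ∧̇ app (# 4) (# 1) (# 0) ∧̇
            graph g (# 1 ▹ # 0 ▹ λ i → suc (suc (suc (suc (suc (xs (suc i))))))) (# 2)))))
  graph (mu f) xs y     =
    (∃̇ (is-zero (# 0) ∧̇ graph f (suc y ▹ suc ∘ xs) (# 0))) ∧̇
    (∀̇ (# 0 <̇ suc y ⊃̇ ∃̇ ∃̇ (# 0 is-suc-of # 1 ∧̇ graph f (# 2 ▹ λ i → suc (suc (suc (xs i)))) (# 0))))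

  graphs : ∀ {m k n} → Vec (PR k) m → (Fin k → Fin n) → (Fin m → Fin n) → Fm n
  graphs []       xs ys = ∀̇ ¬̇ # 0 <̇ # 0  -- Fm has no constant for truth
  graphs (g ∷ gs) xs ys = graph g xs (ys zero) ∧̇ graphs gs xs (ys ∘ suc)

extend : ∀ {A : Set} m {n} → (Fin m → A) → (Fin n → A) → Fin (m + n) → A
extend zero    as ρ = ρ
extend (suc m) as ρ = as zero ▹ extend m (as ∘ suc) ρ

extend-↑ʳ : ∀ {A : Set} m {n} (as : Fin m → A) (ρ : Fin n → A) i → extend m as ρ (m ↑ʳ i) ≡ ρ i
extend-↑ʳ zero    as ρ i = refl
extend-↑ʳ (suc m) as ρ i = extend-↑ʳ m (as ∘ suc) ρ i

extend-↑ˡ : ∀ {A : Set} m {n} (as : Fin m → A) (ρ : Fin n → A) i → extend m as ρ (i ↑ˡ n) ≡ as i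
extend-↑ˡ (suc m) as ρ zero    = refl
extend-↑ˡ (suc m) as ρ (suc i) = extend-↑ˡ m (as ∘ suc) ρ i

module Derived {A : Set} (Rel : Fin 4 → A → A → Set) (App : A → A → A → Set) where
  open Eval Rel App

  ⟦∃̇^⟧⇒ : ∀ m {n} {φ : Fm (m + n)} {ρ} → ⟦ ∃̇^ m φ ⟧ ρ → Σ (Fin m → A) λ as → ⟦ φ ⟧ (extend m as ρ)
  ⟦∃̇^⟧⇒ zero    s = (λ ()) , s
  ⟦∃̇^⟧⇒ (suc m) s with as , a , t ← ⟦∃̇^⟧⇒ m s = a ▹ as , t

  ⇒⟦∃̇^⟧ : ∀ m {n} {φ : Fm (m + n)} {ρ} (as : Fin m → A) → ⟦ φ ⟧ (extend m as ρ) → ⟦ ∃̇^ m φ ⟧ ρ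
  ⇒⟦∃̇^⟧ zero    as s = s
  ⇒⟦∃̇^⟧ (suc m) as s = ⇒⟦∃̇^⟧ m (as ∘ suc) (as zero , s)

-- Soundness of the graph formulas.

_⇒̇_ : ∀ {P Q : Set} → ¬ P ⊎ Q → P → Q
inj₁ ¬p ⇒̇ p = contradiction p ¬p
inj₂ q  ⇒̇ _ = q

module Soundness {A : Set} (Rel : Fin 4 → A → A → Set) (App : A → A → A → Set)
  (arith : Eval.⟦_⟧ Rel App arithmetic ∅) (lt-wf : WellFounded (Rel lt-rel)) where
  open Eval Rel App
  open Derived Rel App

  Lt Suc Eq : A → A → Set
  Lt  = Rel lt-rel
  Suc = Rel suc-rel
  Eq  = Rel eq-rel

  Zero : A → Set
  Zero a = Rel zero-rel a a

  lt-trans : ∀ {a b c} → Lt a b → Lt b c → Lt a c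
  lt-trans p q = (proj₁ (proj₂ arith) _ _ _ ⇒̇ p) ⇒̇ q

  suc⇒lt : ∀ {a b} → Suc a b → Lt a b
  suc⇒lt p = proj₁ (proj₂ (proj₂ arith)) _ _ ⇒̇ p

  suc-nonzero : ∀ {a b} → Suc a b → ¬ Zero b
  suc-nonzero p = proj₁ (proj₂ (proj₂ (proj₂ arith))) _ _ ⇒̇ p

  suc-unique : ∀ {a b c} → Suc a c → Suc b c → Eq a b
  suc-unique p q = (proj₁ (proj₂ (proj₂ (proj₂ (proj₂ arith)))) _ _ _ ⇒̇ p) ⇒̇ q

  eq-zero : ∀ {a b} → Eq a b → Zero a → Zero b
  eq-zero p q = (proj₁ (proj₂ (proj₂ (proj₂ (proj₂ (proj₂ arith))))) _ _ ⇒̇ p) ⇒̇ q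

  eq-suc : ∀ {a b c} → Eq a b → Suc c a → Suc c b
  eq-suc p q = (proj₁ (proj₂ (proj₂ (proj₂ (proj₂ (proj₂ (proj₂ arith)))))) _ _ _ ⇒̇ p) ⇒̇ q

  zero-or-suc : ∀ a → Zero a ⊎ Σ A λ b → Suc b a
  zero-or-suc = proj₂ (proj₂ (proj₂ (proj₂ (proj₂ (proj₂ (proj₂ arith))))))

  -- Counts predecessor steps down to a zero. `Zero` and `Suc` are mere relations on `A`, so
  -- existence of the number comes from well-foundedness in `denotation` and its uniqueness from the
  -- axioms in `den-functional`.
  data Denotes : A → ℕ → Set where
    den-zero : ∀ {a} → Zero a → Denotes a 0
    den-suc  : ∀ {a b n} → Suc a b → Denotes a n → Denotes b (suc n)

  den-eq : ∀ {a b n} → Eq a b → Denotes a n → Denotes b n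
  den-eq e (den-zero z)  = den-zero (eq-zero e z)
  den-eq e (den-suc s d) = den-suc (eq-suc e s) d

  -- Predecessors are unique only up to `Eq`, so one derivation is transported by `den-eq` before
  -- the two are compared.
  den-functional : ∀ {a m n} → Denotes a m → Denotes a n → m ≡ n
  den-functional (den-zero _) (den-zero _)   = refl
  den-functional (den-zero z) (den-suc s _)  = contradiction z (suc-nonzero s)
  den-functional (den-suc s _) (den-zero z)  = contradiction z (suc-nonzero s)
  den-functional (den-suc s d) (den-suc t e) = cong suc (den-functional (den-eq (suc-unique s t) d) e)

  denotation : ∀ a → Acc Lt a → Σ ℕ (Denotes a)
  denotation a (acc rs) with zero-or-suc a
  ... | inj₁ z = 0 , den-zero z
  ... | inj₂ (b , s) with n , d ← denotation b (rs (suc⇒lt s)) = suc n , den-suc s d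

  rank : A → ℕ
  rank a = proj₁ (denotation a (lt-wf a))

  den-rank : ∀ a → Denotes a (rank a)
  den-rank a = proj₂ (denotation a (lt-wf a))

  rank-zero : ∀ {a} → Zero a → rank a ≡ 0
  rank-zero z = den-functional (den-rank _) (den-zero z)

  rank-suc : ∀ {a b} → Suc a b → rank b ≡ suc (rank a)
  rank-suc s = den-functional (den-rank _) (den-suc s (den-rank _))

  rank-eq : ∀ {a b} → Eq a b → rank b ≡ rank a
  rank-eq e = den-functional (den-rank _) (den-eq e (den-rank _))

  -- The predecessors met on the way down pass through every smaller number, and transitivity keeps
  -- them below `a`. Thus the bounded quantifier in the formula for `mu` misses no smaller argument.
  smaller-denotation : ∀ {a m} → Denotes a m → ∀ {n} → n < m → Σ A λ b → Lt b a × Denotes b n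
  smaller-denotation (den-suc {a} s d) {n} n<1+m with m<1+n⇒m<n∨m≡n n<1+m
  ... | inj₂ refl = a , suc⇒lt s , d
  ... | inj₁ n<m with b , b<a , e ← smaller-denotation d n<m = b , lt-trans b<a (suc⇒lt s) , e

  ranks : ∀ {k} → (Fin k → A) → Vec ℕ k
  ranks as = tabulate (rank ∘ as)

  ranks-cong : ∀ {k} {as bs : Fin k → A} → (∀ i → as i ≡ bs i) → ranks as ≡ ranks bs
  ranks-cong as≗bs = tabulate-cong (cong rank ∘ as≗bs)

  mutual
    graph-sound : ∀ {k n} (g : PR k) (xs : Fin k → Fin n) y ρ → ⟦ graph g xs y ⟧ ρ →
      g [ ranks (ρ ∘ xs) ]⇓ rank (ρ y)
    graph-sound zer xs y ρ s rewrite rank-zero s = ev-zer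
    graph-sound succ xs y ρ s rewrite rank-suc s = ev-succ
    graph-sound (proj i) xs y ρ s rewrite rank-eq s = subst (proj i [ _ ]⇓_) (lookup∘tabulate _ i) ev-proj
    graph-sound (comp {m} f gs) xs y ρ s with as , ss , t ← ⟦∃̇^⟧⇒ m s = ev-comp
      (subst₂ (gs [_]⇓*_) (ranks-cong λ i → extend-↑ʳ m as ρ (xs i)) (ranks-cong (extend-↑ˡ m as ρ))
        (graphs-sound gs _ _ _ ss))
      (subst₂ (f [_]⇓_) (ranks-cong (extend-↑ˡ m as ρ)) (cong rank (extend-↑ʳ m as ρ y))
        (graph-sound f _ _ _ t))
    graph-sound (rec f g) xs y ρ (r , start , justified) = computes _ (lt-wf _) _ start
      where
      -- Each pair in the table rests on a pair at a predecessor, so well-founded induction shows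
      -- that any justified table, whichever strategy `r` is, contains only correct pairs.
      computes : ∀ i → Acc Lt i → ∀ a → App r i a → rec f g [ rank i ∷ ranks (ρ ∘ xs ∘ suc) ]⇓ rank a
      computes i (acc rs) a p with justified i a ⇒̇ p
      ... | inj₁ (z , s) rewrite rank-zero z = ev-rec0 (graph-sound f _ _ _ s)
      ... | inj₂ (j , b , j+1 , q , s) rewrite rank-suc j+1 =
        ev-recS (computes j (rs (suc⇒lt j+1)) b q) (graph-sound g _ _ _ s)
    graph-sound (mu f) xs y ρ ((o , z , s) , below) = ev-mu
      (subst (f [ rank (ρ y) ∷ ranks (ρ ∘ xs) ]⇓_) (rank-zero z) (graph-sound f _ _ _ s)) positive
      where
      positive : ∀ n → n < rank (ρ y) → Σ ℕ λ v → f [ n ∷ ranks (ρ ∘ xs) ]⇓ suc v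
      positive n n<y with b , b<y , d ← smaller-denotation (den-rank (ρ y)) n<y
        with refl ← den-functional d (den-rank b)
        with v , w , v+1 , t ← below b ⇒̇ b<y =
        rank v , subst (f [ rank b ∷ ranks (ρ ∘ xs) ]⇓_) (rank-suc v+1) (graph-sound f _ _ _ t)

    graphs-sound : ∀ {m k n} (gs : Vec (PR k) m) (xs : Fin k → Fin n) (ys : Fin m → Fin n) ρ →
      ⟦ graphs gs xs ys ⟧ ρ → gs [ ranks (ρ ∘ xs) ]⇓* ranks (ρ ∘ ys)
    graphs-sound []       xs ys ρ _        = ev-nil
    graphs-sound (g ∷ gs) xs ys ρ (s , ss) = ev-cons (graph-sound g xs _ ρ s) (graphs-sound gs xs _ ρ ss)

-- The template formula and the sentences obtained from it.

halts-with-0 : PR 1 → Fm 1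
halts-with-0 g = ∃̇ (is-zero (# 0) ∧̇ graph g (λ _ → # 1) (# 0))

open Template (toSL arithmetic) (relSL zero-rel 0 0) (relSL suc-rel 0 1) (relSL eq-rel 1 0)

weaken-freeVars : ∀ {m n} φ → m ≤ n → FreeVarsBelow m φ → FreeVarsBelow n φ
weaken-freeVars φ m≤n φ<m z n≤z = φ<m z (≤-trans m≤n n≤z)

and-freeVars : ∀ {n} φ ψ → FreeVarsBelow n φ → FreeVarsBelow n ψ → FreeVarsBelow n (and φ ψ)
and-freeVars φ ψ φ<n ψ<n z n≤z = ∨-false (φ<n z n≤z) (ψ<n z n≤z)

-- `climb` requantifies variable 0 while variable 1 is still open, a case outside `exists-freeVars`.
rebind-freeVars : ∀ {n} x φ → FreeVarsBelow n φ → FreeVarsBelow n (exists x φ)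
rebind-freeVars x φ φ<n z n≤z rewrite φ<n z n≤z = ∧-zeroʳ _

climb-freeVars : ∀ k ψ → FreeVarsBelow 1 ψ → FreeVarsBelow 1 (climb k ψ)
climb-freeVars zero ψ ψ<1 = ψ<1
climb-freeVars (suc k) ψ ψ<1 = exists-freeVars (and σ (exists 0 (and ε χ)))
  (and-freeVars σ (exists 0 (and ε χ)) (relSL-freeVars suc-rel (s≤s z≤n) (s≤s (s≤s z≤n)))
    (rebind-freeVars 0 (and ε χ)
      (and-freeVars ε χ (relSL-freeVars eq-rel (s≤s (s≤s z≤n)) (s≤s z≤n))
        (weaken-freeVars χ (s≤s z≤n) (climb-freeVars k ψ ψ<1)))))
  where
  σ = relSL suc-rel 0 1
  ε = relSL eq-rel 1 0
  χ = climb k ψ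

climb-noFreeAg : ∀ k ψ → NoFreeAg ψ → NoFreeAg (climb k ψ)
climb-noFreeAg zero ψ ψ-closed = ψ-closed
climb-noFreeAg (suc k) ψ ψ-closed a = ∨-false (afterPlaying-noFreeAg 0 1 (atom suc-rel) a)
  (∨-false (afterPlaying-noFreeAg 1 0 (atom eq-rel) a) (climb-noFreeAg k ψ ψ-closed a))

plug-sentence : ∀ k (φ : Fm 1) → Sentence (plug k (toSL φ))
plug-sentence k φ =
  (λ a → ∨-false (toSL-noFreeAg arithmetic a)
    (∨-false (afterPlaying-noFreeAg 0 0 (atom zero-rel) a) (climb-noFreeAg k (toSL φ) (toSL-noFreeAg φ) a))) ,
  λ z → and-freeVars (toSL arithmetic) (exists 0 (and ζ χ)) (toSL-freeVars arithmetic)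
    (exists-freeVars (and ζ χ) (and-freeVars ζ χ (relSL-freeVars zero-rel (s≤s z≤n) (s≤s z≤n))
      (climb-freeVars k (toSL φ) (toSL-freeVars φ)))) z z≤n
  where
  ζ = relSL zero-rel 0 0
  χ = climb k (toSL φ)

-- Soundness of the sentences in every finite game.

module PlugSoundness (G : FinCGS 4 2) where
  open FinCGS G using (nAc)
  open Semantics G
  open StrategyStructure G

  -- Over constant strategies the order axioms make lt-rel a strict order on the
  -- finite set of actions; only the first action of a strategy matters to it.
  lt-wellFounded : ⟦ arithmetic ⟧ ∅ → WellFounded (Rel lt-rel)
  lt-wellFounded (irrefl , transitive , _) =
    Subrelation.wellFounded first-action (wellFounded (λ σ → σ root) (spo-wellFounded isStrict))
    where
    _⊏_ : Fin nAc → Fin nAc → Set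
    a ⊏ b = Rel lt-rel (const a) (const b)

    isStrict : IsStrictPartialOrder _≡_ _⊏_
    isStrict = record
      { isEquivalence = isEquivalence
      ; irrefl        = λ { refl → irrefl _ }
      ; trans         = λ p q → (transitive _ _ _ ⇒̇ p) ⇒̇ q
      ; <-resp-≈      = resp₂ _⊏_
      }

    first-action : ∀ {σ τ} → Rel lt-rel σ τ → σ root ⊏ τ root
    first-action (f , refl , refl , p) = (λ a → const (f a root)) , refl , refl , p

  module _ (arith : ⟦ arithmetic ⟧ ∅) where
    open Soundness Rel App arith (lt-wellFounded arith)

    -- Each round overwrites variables 0 and 1, so the assignment reached is left existential. What
    -- is tracked is the rank of variable 0: `τ` is a successor of `σ`, and `υ` is a copy of `τ` up
    -- to `Eq`.
    climb-sound : ∀ k ψ χ {σ} → varOf χ 0 ≡ just σ → Sat (climb k ψ) χ root →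
      Σ Assignment λ χ′ → Σ Strategy λ σ′ → varOf χ′ 0 ≡ just σ′ × rank σ′ ≡ k + rank σ × Sat ψ χ′ root
    climb-sound zero ψ χ χ0 s = χ , _ , χ0 , refl , s
    climb-sound (suc k) ψ χ {σ} χ0 (τ , s , υ , e , t)
      with χ′ , σ′ , χ′0 , r , u ← climb-sound k ψ (setVar (setVar χ 1 τ) 0 υ) refl t =
      χ′ , σ′ , χ′0 , trans r eq , u
      where
      τ-rank : rank τ ≡ suc (rank σ)
      τ-rank = rank-suc (Sat⇒Rel suc-rel 0 1 (setVar χ 1 τ) χ0 refl s)
      υ-rank : rank υ ≡ rank τ
      υ-rank = rank-eq (Sat⇒Rel eq-rel 1 0 (setVar (setVar χ 1 τ) 0 υ) refl refl e)
      eq : k + rank υ ≡ suc k + rank σ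
      eq = trans (cong (k +_) (trans υ-rank τ-rank)) (+-suc k (rank σ))

    halts-sound : ∀ g χ {σ} → varOf χ 0 ≡ just σ → Sat (toSL (halts-with-0 g)) χ root → g [ rank σ ∷ [] ]⇓ 0
    halts-sound g χ {σ} χ0 s with o , z , t ← Sat⇒⟦⟧ (halts-with-0 g) χ {σ ▹ ∅} (λ { zero → χ0 }) s =
      subst (g [ rank σ ∷ [] ]⇓_) (rank-zero z) (graph-sound g _ _ _ t)

    zero-climb-sound : ∀ k g →
      Sat (exists 0 (and (relSL zero-rel 0 0) (climb k (toSL (halts-with-0 g))))) empty root →
      g [ k ∷ [] ]⇓ 0
    zero-climb-sound k g (σ , z , s)
      with χ′ , σ′ , χ′0 , r , t ← climb-sound k _ (setVar empty 0 σ) refl s =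
      subst (λ n → g [ n ∷ [] ]⇓ 0) rank-σ′ (halts-sound g χ′ χ′0 t)
      where
      rank-σ : rank σ ≡ 0
      rank-σ = rank-zero (Sat⇒Rel zero-rel 0 0 (setVar empty 0 σ) refl refl z)
      rank-σ′ : rank σ′ ≡ k
      rank-σ′ = trans r (trans (cong (k +_) rank-σ) (+-identityʳ k))

  plug-sound : ∀ k g → Models (plug k (toSL (halts-with-0 g))) → g [ k ∷ [] ]⇓ 0
  plug-sound k g (s , t) = zero-climb-sound (Sat⇒⟦⟧ arithmetic empty {∅} (λ ()) s) k g t

-- The standard game on an initial segment of the numbers.

Std : Fin 4 → ℕ → ℕ → Set
Std zero                   m n = m < n
Std (suc zero)             m n = suc m ≡ n
Std (suc (suc zero))       m n = m ≡ 0
Std (suc (suc (suc zero))) m n = m ≡ n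

std? : ∀ j m n → Dec (Std j m n)
std? zero                   m n = m <? n
std? (suc zero)             m n = suc m ≟ n
std? (suc (suc zero))       m n = m ≟ 0
std? (suc (suc (suc zero))) m n = m ≟ n

imply : ∀ {P Q : Set} → Dec P → (P → Q) → ¬ P ⊎ Q
imply (yes p) f = inj₂ (f p)
imply (no ¬p) f = inj₁ ¬p

-- Every joint action leads to a state recording it; numbers up to 1 + b are actions.
module Model (b : ℕ) where
  N : ℕ
  -- All numbers up to `b` are actions, and even for `b = 0` there are two actions, as the answers
  -- yes and no require.
  N = suc (suc b)

  StdPair : Fin 4 → Fin N × Fin N → Set
  StdPair j (x , y) = Std j (toℕ x) (toℕ y)

  std?-pair : ∀ j p → Dec (StdPair j p)
  std?-pair j (x , y) = std? j (toℕ x) (toℕ y)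

  game : FinCGS 4 2
  game = record
    { nAc     = N
    ; nSt     = N * N
    ; nAc-pos = s≤s z≤n
    ; label   = λ s j → isYes (std?-pair j (remQuot N s))
    ; trans   = λ _ a → combine (a (# 0)) (a (# 1))
    ; s₀      = combine {N} {N} zero zero
    }

  open Semantics game
  open StrategyStructure game
  open Derived Rel App

  val : Strategy → ℕ
  val σ = toℕ (σ root)

  numeral : ∀ {n} → n ≤ b → Strategy
  numeral n≤b _ = fromℕ< (s≤s (m≤n⇒m≤1+n n≤b))

  val-numeral : ∀ {n} (n≤b : n ≤ b) → val (numeral n≤b) ≡ n
  val-numeral n≤b = toℕ-fromℕ< _

  val-pred : ∀ {σ n} → suc n ≡ val σ → n ≤ b
  val-pred {σ} eq = s≤s⁻¹ (s≤s⁻¹ (subst (_< N) (sym eq) (toℕ<n (σ root))))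

  labelled⇒std : ∀ j (x y : Fin N) {h} → Labelled j (combine x y ∷⁺ h) → Std j (toℕ x) (toℕ y)
  labelled⇒std j x y l = subst (StdPair j) (remQuot-combine x y)
    (toWitness {a? = std?-pair j (remQuot N (combine x y))} l)

  std⇒labelled : ∀ j (x y : Fin N) {h} → Std j (toℕ x) (toℕ y) → Labelled j (combine x y ∷⁺ h)
  std⇒labelled j x y p = fromWitness {a? = std?-pair j (remQuot N (combine x y))}
    (subst (StdPair j) (sym (remQuot-combine x y)) p)

  rel⇒std : ∀ j {σ τ} → Rel j σ τ → Std j (val σ) (val τ)
  rel⇒std j (f , refl , refl , l) = labelled⇒std j _ _ {root} l

  joint : Strategy → Strategy → Fin 2 → Strategy
  joint σ τ = σ ▹ τ ▹ ∅

  std⇒rel : ∀ j {σ τ} → Std j (val σ) (val τ) → Rel j σ τ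
  std⇒rel j {σ} {τ} p = joint σ τ , refl , refl , std⇒labelled j (σ root) (τ root) {root} p

  rel? : ∀ j σ τ → Dec (Rel j σ τ)
  rel? j σ τ = map′ (std⇒rel j) (rel⇒std j) (std? j (val σ) (val τ))

  assuming : ∀ j σ τ {Q : Set} → (Std j (val σ) (val τ) → Q) → ¬ Rel j σ τ ⊎ Q
  assuming j σ τ f = imply (rel? j σ τ) (f ∘ rel⇒std j)

  arithmetic-holds : ⟦ arithmetic ⟧ ∅
  arithmetic-holds =
    (λ a p → <-irrefl refl (rel⇒std lt-rel p)) ,
    (λ c d a → assuming lt-rel a d λ p → assuming lt-rel d c λ q → std⇒rel lt-rel (<-trans p q)) ,
    (λ c a → assuming suc-rel a c λ p → std⇒rel lt-rel (≤-reflexive p)) ,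
    (λ c a → assuming suc-rel a c λ p z → 1+n≢0 (trans p (rel⇒std zero-rel z))) ,
    (λ c d a → assuming suc-rel a c λ p → assuming suc-rel d c λ q →
      std⇒rel eq-rel (suc-injective (trans p (sym q)))) ,
    (λ c a → assuming eq-rel a c λ p → assuming zero-rel a a λ q → std⇒rel zero-rel (trans (sym p) q)) ,
    (λ c d a → assuming eq-rel a d λ p → assuming suc-rel c a λ q → std⇒rel suc-rel (trans q p)) ,
    zero-or-suc
    where
    zero-or-suc : ∀ a → Rel zero-rel a a ⊎ Σ Strategy λ c → Rel suc-rel c a
    zero-or-suc a with val a in eq
    ... | zero  = inj₁ (std⇒rel zero-rel eq)
    ... | suc n = inj₂ (numeral n≤b , std⇒rel suc-rel (trans (cong suc (val-numeral n≤b)) (sym eq)))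
      where n≤b = val-pred {a} (sym eq)

  -- After one move the current state records the pair just played, so `r` looks the pair up there
  -- and answers with action 0 for yes and 1 for no.
  comprehension : {P : ℕ → ℕ → Set} → (∀ m n → Dec (P m n)) → Σ Strategy λ r →
    ∀ σ τ → (P (val σ) (val τ) → App r σ τ) × (App r σ τ → P (val σ) (val τ))
  comprehension {P} P? = r , λ σ τ → to σ τ , from σ τ
    where
    answer : ∀ {Q : Set} → Dec Q → Fin N
    answer (yes _) = zero
    answer (no _)  = suc zero

    PPair : Fin N × Fin N → Set
    PPair (x , y) = P (toℕ x) (toℕ y)

    p? : ∀ q → Dec (PPair q)
    p? (x , y) = P? (toℕ x) (toℕ y)

    r : Strategy
    r h = answer (p? (remQuot N (head h)))

    answer-yes : ∀ {Q : Set} (q? : Dec Q) → Q → toℕ (answer q?) ≡ 0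
    answer-yes (yes _) _ = refl
    answer-yes (no ¬q) q = contradiction q ¬q

    yes-answer : ∀ {Q : Set} (q? : Dec Q) → toℕ (answer q?) ≡ 0 → Q
    yes-answer (yes q) _ = q

    to : ∀ σ τ → P (val σ) (val τ) → App r σ τ
    to σ τ p = joint σ τ , refl , refl , joint r r , refl , refl ,
      std⇒labelled zero-rel (r h) (r h) {h} (answer-yes (p? (remQuot N (head h)))
        (subst PPair (sym (remQuot-combine (σ root) (τ root))) p))
      where h = combine (σ root) (τ root) ∷⁺ root

    from : ∀ σ τ → App r σ τ → P (val σ) (val τ)
    from σ τ (f , refl , refl , f′ , f′0≡r , _ , l) =
      subst PPair (remQuot-combine (σ root) (τ root)) (yes-answer (p? (remQuot N (head h)))
        (trans (cong (λ ρ → toℕ (ρ h)) (sym f′0≡r)) (labelled⇒std zero-rel (f′ (# 0) h) (f′ (# 1) h) {h} l)))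
      where h = combine (σ root) (τ root) ∷⁺ root

  -- Quantifies over all contexts and positions of the variables because graph formulas recur under
  -- varying numbers of binders.
  Holds : ∀ {k} → PR k → Vec ℕ k → ℕ → Set
  Holds {k} g ns m = ∀ n (xs : Fin k → Fin n) y ρ →
    (∀ i → val (ρ (xs i)) ≡ lookup ns i) → val (ρ y) ≡ m → ⟦ graph g xs y ⟧ ρ

  Holds* : ∀ {k l} → Vec (PR k) l → Vec ℕ k → Vec ℕ l → Set
  Holds* {k} {l} gs ns ms = ∀ n (xs : Fin k → Fin n) (ys : Fin l → Fin n) ρ →
    (∀ i → val (ρ (xs i)) ≡ lookup ns i) → (∀ i → val (ρ (ys i)) ≡ lookup ms i) → ⟦ graphs gs xs ys ⟧ ρ

  comp-holds : ∀ {k l} (f : PR l) (gs : Vec (PR k) l) ns ms {m} → (∀ i → lookup ms i ≤ b) →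
    Holds* gs ns ms → Holds f ms m → Holds (comp f gs) ns m
  comp-holds {l = l} f gs ns ms ms≤b hs h n xs y ρ vxs vy = ⇒⟦∃̇^⟧ l as
    ( hs _ _ _ _ (λ i → trans (cong val (extend-↑ʳ l as ρ (xs i))) (vxs i)) vas
    , h _ _ _ _ vas (trans (cong val (extend-↑ʳ l as ρ y)) vy))
    where
    as : Fin l → Strategy
    as i = numeral (ms≤b i)
    vas : ∀ i → val (extend l as ρ (i ↑ˡ _)) ≡ _
    vas i = trans (cong val (extend-↑ˡ l as ρ i)) (val-numeral (ms≤b i))

  -- Numerical counterpart of the disjunction in the formula for `rec`, with table `P`. The bound on
  -- `c` lets a numeral witness the previous value.
  JustifiedBy : ∀ {k} → PR k → PR (suc (suc k)) → Vec ℕ k → (ℕ → ℕ → Set) → ℕ → ℕ → Set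
  JustifiedBy f g ns P i a =
    (i ≡ 0 × Holds f ns a) ⊎
    (Σ ℕ λ j → Σ ℕ λ c → suc j ≡ i × P j c × c ≤ b × Holds g (j ∷ c ∷ ns) a)

  Justified : ∀ {k} → PR k → PR (suc (suc k)) → Vec ℕ k → (ℕ → ℕ → Set) → Set
  Justified f g ns P = ∀ i a → P i a → JustifiedBy f g ns P i a

  justifiedBy-mono : ∀ {k} (f : PR k) g ns {P Q : ℕ → ℕ → Set} {i a} → (∀ {j c} → P j c → Q j c) →
    JustifiedBy f g ns P i a → JustifiedBy f g ns Q i a
  justifiedBy-mono f g ns P⇒Q = map₂ λ (j , c , eq , p , rest) → j , c , eq , P⇒Q p , rest

  rec-holds : ∀ {k} (f : PR k) g {ns i m} {P : ℕ → ℕ → Set} → (∀ i a → Dec (P i a)) →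
    P i m → Justified f g ns P → Holds (rec f g) (i ∷ ns) m
  rec-holds f g {ns} {P = P} P? p justified n xs y ρ vxs vy =
    r , proj₁ (r-spec _ _) (subst₂ P (sym (vxs zero)) (sym vy) p) ,
    -- `⊃̇` abbreviates a disjunction, so membership in the table has to be decided.
    λ σ τ → imply (map′ (proj₁ (r-spec σ τ)) (proj₂ (r-spec σ τ)) (P? _ _))
      λ q → justify σ τ (justified _ _ (proj₂ (r-spec σ τ) q))
    where
    r : Strategy
    r = proj₁ (comprehension P?)
    r-spec : ∀ σ τ → (P (val σ) (val τ) → App r σ τ) × (App r σ τ → P (val σ) (val τ))
    r-spec = proj₂ (comprehension P?)
    justify : ∀ σ τ → _ → _
    justify σ τ (inj₁ (i≡0 , h)) = inj₁ (std⇒rel zero-rel i≡0 , h _ _ _ _ (vxs ∘ suc) refl)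
    justify σ τ (inj₂ (j , c , 1+j≡i , q , c≤b , h)) = inj₂
      ( numeral j≤b , numeral c≤b
      , std⇒rel suc-rel (trans (cong suc vj) 1+j≡i)
      , proj₁ (r-spec _ _) (subst₂ P (sym vj) (sym vc) q)
      , h _ _ _ _ (λ { zero → vj ; (suc zero) → vc ; (suc (suc i)) → vxs (suc i) }) refl)
      where
      j≤b = val-pred {σ} 1+j≡i
      vj = val-numeral j≤b
      vc = val-numeral c≤b

  mu-holds : ∀ {k} (f : PR (suc k)) {ns m} → Holds f (m ∷ ns) 0 →
    (∀ z → z < m → Σ ℕ λ v → suc v ≤ b × Holds f (z ∷ ns) (suc v)) → Holds (mu f) ns m
  mu-holds f {ns} {m} h below n xs y ρ vxs vy =
    (numeral z≤n , std⇒rel zero-rel (val-numeral z≤n) ,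
      h _ _ _ _ (λ { zero → vy ; (suc i) → vxs i }) (val-numeral z≤n)) ,
    λ σ → assuming lt-rel σ (ρ y) λ σ<y → positive σ (below (val σ) (subst (val σ <_) vy σ<y))
    where
    positive : ∀ σ → (Σ ℕ λ v → suc v ≤ b × Holds f (val σ ∷ ns) (suc v)) → _
    positive σ (v , 1+v≤b , h′) =
      numeral v≤b , numeral 1+v≤b ,
      std⇒rel suc-rel (trans (cong suc (val-numeral v≤b)) (sym (val-numeral 1+v≤b))) ,
      h′ _ _ _ _ (λ { zero → refl ; (suc i) → vxs i }) (val-numeral 1+v≤b)
      where v≤b = ≤-trans (n≤1+n v) 1+v≤b

  -- The last hypothesis is a continuation: it receives whichever assignment the `k` rounds produce.
  -- The bound keeps every number on the way a numeral.
  climb-complete : ∀ k ψ χ σ → varOf χ 0 ≡ just σ → k + val σ ≤ b →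
    (∀ χ′ σ′ → varOf χ′ 0 ≡ just σ′ → val σ′ ≡ k + val σ → Sat ψ χ′ root) → Sat (climb k ψ) χ root
  climb-complete zero ψ χ σ χ0 _ s = s χ σ χ0 refl
  climb-complete (suc k) ψ χ σ χ0 k+σ<b s =
    τ , Rel⇒Sat suc-rel 0 1 (setVar χ 1 τ) χ0 refl (std⇒rel suc-rel (sym vτ)) ,
    τ , Rel⇒Sat eq-rel 1 0 (setVar (setVar χ 1 τ) 0 τ) refl refl (std⇒rel eq-rel {τ} {τ} refl) ,
    climb-complete k ψ _ τ refl (subst (_≤ b) (sym eq) k+σ<b) λ χ′ σ′ χ′0 v → s χ′ σ′ χ′0 (trans v eq)
    where
    σ<b : val σ < b
    σ<b = ≤-trans (s≤s (m≤n+m (val σ) k)) k+σ<b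
    τ = numeral σ<b
    vτ : val τ ≡ suc (val σ)
    vτ = val-numeral σ<b
    eq : k + val τ ≡ suc k + val σ
    eq = trans (cong (k +_) vτ) (+-suc k (val σ))

  plug-complete : ∀ k g → k ≤ b → Holds g (k ∷ []) 0 → Models (plug k (toSL (halts-with-0 g)))
  plug-complete k g k≤b h =
    ⟦⟧⇒Sat arithmetic empty {∅} (λ ()) arithmetic-holds ,
    o , Rel⇒Sat zero-rel 0 0 (setVar empty 0 o) refl refl (std⇒rel zero-rel vo) ,
    climb-complete k _ _ o refl (subst (_≤ b) (sym k+o) k≤b) λ χ σ χ0 v →
      ⟦⟧⇒Sat (halts-with-0 g) χ {σ ▹ ∅} (λ { zero → χ0 })
        (o , std⇒rel zero-rel vo , h _ _ _ _ (λ { zero → trans v k+o }) vo)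
    where
    o : Strategy
    o = numeral z≤n
    vo : val o ≡ 0
    vo = val-numeral z≤n
    k+o : k + val o ≡ k
    k+o = trans (cong (k +_) vo) (+-identityʳ k)

-- Completeness of the graph formulas for all large bounds.

-- The values occurring in a derivation must fit among the actions. Asking for all large bounds lets
-- finitely many requirements be met together by a maximum.
Eventually : (ℕ → Set) → Set
Eventually P = Σ ℕ λ c → ∀ b → c ≤ b → P b

ev-always : ∀ {P : ℕ → Set} → (∀ b → P b) → Eventually P
ev-always p = 0 , λ b _ → p b

ev-map : ∀ {P Q : ℕ → Set} → (∀ b → P b → Q b) → Eventually P → Eventually Q
ev-map f (c , p) = c , λ b c≤b → f b (p b c≤b)

ev-× : ∀ {P Q : ℕ → Set} → Eventually P → Eventually Q → Eventually λ b → P b × Q b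
ev-× (c , p) (d , q) = c ⊔ d , λ b c⊔d≤b → p b (m⊔n≤o⇒m≤o c d c⊔d≤b) , q b (m⊔n≤o⇒n≤o c d c⊔d≤b)

ev-≥ : ∀ n → Eventually (n ≤_)
ev-≥ n = n , λ _ → id

ev-all< : ∀ {P : ℕ → ℕ → Set} m → (∀ z → z < m → Eventually (P z)) → Eventually λ b → ∀ z → z < m → P z b
ev-all< zero ps = ev-always λ _ _ ()
ev-all< {P} (suc m) ps = ev-map snoc (ev-× (ev-all< m λ z z<m → ps z (m<n⇒m<1+n z<m)) (ps m (n<1+n m)))
  where
  snoc : ∀ b → (∀ z → z < m → P z b) × P m b → ∀ z → z < suc m → P z b
  snoc b (below , top) z z<1+m with m<1+n⇒m<n∨m≡n z<1+m
  ... | inj₁ z<m  = below z z<m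
  ... | inj₂ refl = top

open Model using (Holds; Holds*; Justified; justifiedBy-mono; std⇒rel; comp-holds; rec-holds; mu-holds)

Complete : ∀ {k} → PR k → Set
Complete g = ∀ {ns m} → g [ ns ]⇓ m → Eventually λ b → Holds b g ns m

-- The pairs computed along one recursion. They are chosen independently of the bound, of which only
-- the justification speaks, and are decidable so that `comprehension` can turn them into a
-- strategy.
record Table {k} (f : PR k) (g : PR (suc (suc k))) (ns : Vec ℕ k) (i m : ℕ) : Set₁ where
  field
    Entry     : ℕ → ℕ → Set
    entry?    : ∀ j a → Dec (Entry j a)
    result    : Entry i m
    justified : Eventually λ b → Justified b f g ns Entry

table : ∀ {k} (f : PR k) g → Complete f → Complete g →
  ∀ {ns i m} → rec f g [ i ∷ ns ]⇓ m → Table f g ns i m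
table f g cf cg {m = m} (ev-rec0 d) = record
  { Entry     = λ j a → j ≡ 0 × a ≡ m
  ; entry?    = λ j a → j ≟ 0 ×-dec a ≟ m
  ; result    = refl , refl
  ; justified = ev-map (λ { b h _ _ (refl , refl) → inj₁ (refl , h) }) (cf d)
  }
table f g cf cg {ns} {suc i} {m} (ev-recS {r = r} d e) = record
  { Entry     = λ j a → (j ≡ suc i × a ≡ m) ⊎ Entry j a
  ; entry?    = λ j a → (j ≟ suc i ×-dec a ≟ m) ⊎-dec entry? j a
  ; result    = inj₁ (refl , refl)
  ; justified = ev-map
      -- The new pair rests on `result`, the latest pair of the smaller table; old pairs stay
      -- justified because enlarging a table preserves justification.
      (λ { b (js , r≤b , h) → λ
        { _ _ (inj₁ (refl , refl)) → inj₂ (i , r , refl , inj₂ result , r≤b , h)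
        ; j a (inj₂ p) → justifiedBy-mono b f g ns inj₂ (js j a p) } })
      (ev-× justified (ev-× (ev-≥ r) (cg e)))
  }
  where open Table (table f g cf cg d)

mutual
  -- Induction on the program. In `rec` a premise concerns the same program again, so `table` does a
  -- separate induction on the derivation.
  graph-complete : ∀ {k} (g : PR k) → Complete g
  graph-complete zer ev-zer = ev-always λ b n xs y ρ vxs vy → std⇒rel b zero-rel vy
  graph-complete succ ev-succ = ev-always λ b n xs y ρ vxs vy →
    std⇒rel b suc-rel (trans (cong suc (vxs zero)) (sym vy))
  graph-complete (proj i) ev-proj = ev-always λ b n xs y ρ vxs vy →
    std⇒rel b eq-rel (trans (vxs i) (sym vy))
  graph-complete (comp f gs) {ns} (ev-comp {ys = ms} ds d) =
    ev-map (λ { b ((ms≤b , hs) , h) → comp-holds b f gs ns ms ms≤b hs h })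
      (ev-× (graphs-complete gs ds) (graph-complete f d))
  graph-complete (rec f g) {_ ∷ _} d = ev-map (λ b → rec-holds b f g entry? result) justified
    where open Table (table f g (graph-complete f) (graph-complete g) d)
  graph-complete (mu f) {ns} (ev-mu {y = m} d ds) = ev-map (λ { b (h , below) → mu-holds b f h below })
    (ev-× (graph-complete f d) (ev-all< m λ z z<m → positive z (ds z z<m)))
    where
    positive : ∀ z → (Σ ℕ λ v → f [ z ∷ ns ]⇓ suc v) →
      Eventually λ b → Σ ℕ λ v → suc v ≤ b × Holds b f (z ∷ ns) (suc v)
    positive z (v , e) = ev-map (λ b p → v , p) (ev-× (ev-≥ (suc v)) (graph-complete f e))

  graphs-complete : ∀ {k l} (gs : Vec (PR k) l) {ns ms} → gs [ ns ]⇓* ms →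
    Eventually λ b → (∀ i → lookup ms i ≤ b) × Holds* b gs ns ms
  graphs-complete [] ev-nil = ev-always λ b → (λ ()) ,
    λ n xs ys ρ vxs vys a p → <-irrefl refl (Model.rel⇒std b lt-rel p)
  graphs-complete (g ∷ gs) (ev-cons {y = m} d ds) = ev-map
    (λ { b ((m≤b , h) , (ms≤b , hs)) →
      (λ { zero → m≤b ; (suc i) → ms≤b i }) ,
      λ n xs ys ρ vxs vys → h n xs (ys zero) ρ vxs (vys zero) , hs n xs (ys ∘ suc) ρ vxs (vys ∘ suc) })
    (ev-× (ev-× (ev-≥ m) (graph-complete g d)) (graphs-complete gs ds))

-- The diagonal argument.

mkInput : (φ : SL) → Sentence φ → SLInput
mkInput φ φ-sentence = record { p = 3 ; g = 1 ; φ = φ ; sentence = φ-sentence }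

code-mkInput : ∀ φ φ-sentence → code (mkInput φ φ-sentence) ≡ pair 3 (pair 1 (encode φ))
code-mkInput φ φ-sentence = cong (λ c → pair 3 (pair 1 c)) (sym (encode≡codeF φ))

input : ℕ → PR 1 → SLInput
input k g = mkInput (plug k (toSL (halts-with-0 g))) (plug-sentence k (halts-with-0 g))

code-input : ∀ k g → code (input k g) ≡ pair 3 (pair 1 (encode (plug k (toSL (halts-with-0 g)))))
-- `refl` compares the two inputs here, not their codes.
code-input k g = trans (cong code {x = input k g} {y = mkInput φ φ-sentence} refl) (code-mkInput φ φ-sentence)
  where
  φ = plug k (toSL (halts-with-0 g))
  φ-sentence = plug-sentence k (halts-with-0 g)

plugP-input : ∀ g {k} → k ≡ encode (toSL (halts-with-0 g)) → plugP [ k ∷ [] ]⇓ code (input k g)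
plugP-input g {k} refl = subst (plugP [ k ∷ [] ]⇓_) (sym (code-input k g)) (plugP-⇓ (toSL (halts-with-0 g)))

finSat-sound : ∀ k g → FinSat (input k g) → g [ k ∷ [] ]⇓ 0
finSat-sound k g (G , s) = PlugSoundness.plug-sound G k g s

finSat-complete : ∀ k g → g [ k ∷ [] ]⇓ 0 → FinSat (input k g)
finSat-complete k g d with c , h ← ev-× (graph-complete g d) (ev-≥ k) =
  Model.game c , Model.plug-complete c k g (proj₂ (h c ≤-refl)) (proj₁ (h c ≤-refl))

-- If `P i` held, `f` would output 0 on `c i` by soundness and 1 by decision. So `P i` fails, `f`
-- outputs 0, and completeness gives `P i` after all. Refuting `P i` first avoids a case distinction
-- on it.
diagonal : ∀ {I : Set} {P : I → Set} {c : I → ℕ} {f d : PR 1} {k} i → d [ k ∷ [] ]⇓ c i →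
  (P i → (f ⊙ d) [ k ∷ [] ]⇓ 0) → ((f ⊙ d) [ k ∷ [] ]⇓ 0 → P i) → ¬ Decides f P c
diagonal i d⇓ci sound complete decides =
  ¬pi (complete (⊙-⇓ d⇓ci (proj₂ (decides i) ¬pi)))
  where
  ¬pi : ¬ _
  ¬pi pi = 0≢1+n (⇓-deterministic (⊙-inv d⇓ci (sound pi)) (proj₁ (decides i) pi))

theorem4p3 : ¬ (Σ (PR 1) λ f → Decides f FinSat code)
theorem4p3 (f , decides) = diagonal {P = FinSat} {c = code} {f = f} {d = plugP} {k = k} (input k F)
  (plugP-input F refl) (finSat-sound k F) (finSat-complete k F) decides
  where
  F : PR 1
  F = f ⊙ plugP
  k : ℕ
  -- The template about `F` is applied to its own code, so `input k F` speaks of the answer of `f`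
  -- on `input k F` itself.
  k = encode (toSL (halts-with-0 F))
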